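{- Let $H$ be a connected graph of order $p \geq 5$ with cyclomatic number $v(H) = 1$. If $H$ contains a cycle with $k$ vertices, where $3 \leq k \leq p-2$, then for every $n \geq p$ $$\left\lfloor\frac{n}{k-1}\right\rfloor\binom{k-1}{2} + \binom{r}{2} + \left\lceil\frac{n}{k-1}\right\rceil \leq rb(K_n, H) \leq (p-2)n - p \cdot \frac{p-3}{2},$$ where $r$ is the residue of $n$ modulo $k-1$.
   Context: For a graph $H$ and an integer $n$, the rainbow number $rb(K_n,H)$ is the minimum number $m$ such that every edge-colouring of the complete graph $K_n$ using at least $m$ colours contains a rainbow copy of $H$, i.e. a subgraph isomorphic to $H$ whose edges all have distinct colours. The cyclomatic number of a connected graph $G$ is $v(G) = |E(G)| - |V(G)| + 1$. -}

module Defs where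

open import Data.Nat using (ℕ; zero; suc; _+_; _*_; _∸_; _≤_; _<_)
open import Data.Nat.DivMod using (_/_; _%_)
open import Data.Nat.Combinatorics using (_C_)
open import Data.Fin using (Fin; toℕ; _<?_)
open import Data.Fin.Properties using (_≟_)
open import Data.Bool using (Bool; true; false; T)
open import Data.List using (List; length; filter; cartesianProduct; allFin)
open import Data.Product using (_×_; _,_; Σ; ∃)
open import Data.Sum using (_⊎_)
open import Relation.Binary.PropositionalEquality using (_≡_; _≢_)
open import Relation.Nullary.Decidable using (_×-dec_; T?)
open import Function.Definitions using (Injective)
open import Relation.Nullary using (yes; no)
open import Data.Product using (proj₁; proj₂)

record Graph (p : ℕ) : Set where
  field
    adj   : Fin p → Fin p → Bool
    sym   : ∀ u v → adj u v ≡ adj v u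
    irref : ∀ u → adj u u ≡ false
open Graph public

Adj : ∀ {p} → Graph p → Fin p → Fin p → Set
Adj G u v = T (adj G u v)

edgeList : ∀ {p} → Graph p → List (Fin p × Fin p)
edgeList {p} G =
  filter (λ e → (proj₁ e <? proj₂ e) ×-dec T? (adj G (proj₁ e) (proj₂ e)))
         (cartesianProduct (allFin p) (allFin p))

numEdges : ∀ {p} → Graph p → ℕ
numEdges G = length (edgeList G)

data Walk {p} (G : Graph p) : Fin p → Fin p → Set where
  here : ∀ {u} → Walk G u u
  step : ∀ {u v w} → Adj G u v → Walk G v w → Walk G u w

Connected : ∀ {p} → Graph p → Set
Connected G = ∀ u v → Walk G u v

-- cyclomatic number v(G) = |E(G)| - |V(G)| + 1, as an integer equation:
-- v(G) = c  is expressed as  |E(G)| + 1 ≡ c + |V(G)|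
HasCyclomaticNumber : ∀ {p} → Graph p → ℕ → Set
HasCyclomaticNumber {p} G c = numEdges G + 1 ≡ c + p

cycNext : ∀ {k} → Fin k → Fin k
cycNext {suc k} i with toℕ i Data.Nat.<? k
... | yes i<k = Data.Fin.suc (Data.Fin.fromℕ< i<k)
... | no _ = Data.Fin.zero

ContainsCycle : ∀ {p} → Graph p → ℕ → Set
ContainsCycle {p} G k =
  3 ≤ k × Σ (Fin k → Fin p) λ c → Injective _≡_ _≡_ c × (∀ i → Adj G (c i) (c (cycNext i)))

-- An edge-colouring of K_n using exactly t colours: a symmetric map on
-- ordered pairs of distinct vertices (diagonal values irrelevant) into
-- Fin t such that every one of the t colours is used on some edge.
record Colouring (n t : ℕ) : Set where
  field
    col  : Fin n → Fin n → Fin t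
    csym : ∀ i j → col i j ≡ col j i
    surj : ∀ a → Σ (Fin n) λ i → Σ (Fin n) λ j → i ≢ j × col i j ≡ a
open Colouring public

RainbowCopy : ∀ {n t p} → Colouring n t → Graph p → Set
RainbowCopy {n} {t} {p} χ H =
  Σ (Fin p → Fin n) λ f → Injective _≡_ _≡_ f ×
    (∀ u v u' v' → Adj H u v → Adj H u' v' →
       col χ (f u) (f v) ≡ col χ (f u') (f v') →
       (u ≡ u' × v ≡ v') ⊎ (u ≡ v' × v ≡ u'))

RbProperty : ∀ {p} → ℕ → Graph p → ℕ → Set
RbProperty n H m = ∀ t → m ≤ t → (χ : Colouring n t) → RainbowCopy χ H

IsRainbowNumber : ∀ {p} → ℕ → Graph p → ℕ → Set
IsRainbowNumber n H m = RbProperty n H m × (∀ m' → RbProperty n H m' → m ≤ m')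

⌈_/_⌉ : ℕ → (d : ℕ) → .{{_ : Data.Nat.NonZero d}} → ℕ
⌈ a / d ⌉ = (a + (d ∸ 1)) / d

-- Upper bound: delete vertices one at a time as long as this destroys at most p - 2 colours. As
-- p - 1 vertices cannot carry the colours that remain, one gets stuck at a set S in which
-- every vertex u has at least p - 1 private colours, that is, colours all of whose edges within S
-- contain u. Then a rainbow copy of H can be embedded greedily: the two arms of the cycle grow
-- from a root along edges whose colours are private to their tails, so that the edge closing the
-- cycle, which contains none of the tails, automatically has a new colour; the remaining vertices
-- are hung on one after the other, private colours never being exhausted by p - 1 used vertices.
-- Since H has as many edges as vertices, these edges are all the edges of H.
--
-- Lower bound: split the vertices into rainbow blocks of k - 1 vertices (the first one of r if
-- r > 0), and add one colour per block after the first for all the edges joining it to its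
-- predecessors. A cycle of length k does not fit in a block, so it has two edges of the same
-- joining colour.
module Submission where

open import Defs
open import Data.Bool using (Bool; true; false; T)
open import Data.Bool.Properties using () renaming (_≟_ to _≟ᵇ_)
open import Data.Empty using (⊥; ⊥-elim)
open import Data.Fin using (Fin; toℕ; fromℕ<; splitAt; join; _↑ʳ_)
import Data.Fin as Fin
open import Data.Fin.Properties
  using (_≟_; any?; <-cmp; toℕ-fromℕ<; toℕ<n; toℕ-injective; injective⇒≤;
         splitAt-join; join-splitAt)
open import Data.List using (List; []; _∷_; [_]; _++_; length; map; filter; allFin)
import Data.List.Membership.DecPropositional as DecMembership
open import Data.List.Membership.Propositional using (_∈_; _∉_; find; lose)
open import Data.List.Membership.Propositional.Properties
  using (∈-∃++; ∈-++⁺ˡ; ∈-++⁺ʳ; ∈-++⁻; ∈-filter⁺; ∈-filter⁻; ∈-map⁺; ∈-map⁻; ∈-allFin;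
         ∈-cartesianProduct⁺)
open import Data.List.Properties using (length-map; length-++; filter-notAll; length-tabulate)
open import Data.List.Relation.Binary.Subset.Propositional using (_⊆_)
open import Data.List.Relation.Unary.All as All using (All; []; _∷_)
open import Data.List.Relation.Unary.All.Properties using (¬Any⇒All¬)
open import Data.List.Relation.Unary.AllPairs using ([]; _∷_)
open import Data.List.Relation.Unary.Any as Any using (Any; here; there)
open import Data.List.Relation.Unary.Unique.Propositional using (Unique)
open import Data.List.Relation.Unary.Unique.Propositional.Properties using (allFin⁺; filter⁺)
open import Data.Nat using (ℕ; zero; suc; _+_; _*_; _∸_; _≤_; _<_; _≤?_; _<?_; z≤n; s≤s)
open import Data.Nat.Combinatorics using (_C_; nC1≡n; nCk+nC[k+1]≡[n+1]C[k+1])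
open import Data.Nat.DivMod
  using (_/_; _%_; _mod_; m<n⇒m%n≡m; m≡m%n+[m/n]*n; m%n<n; m<n*o⇒m/o<n)
open import Data.Nat.Properties
  using (≤-refl; ≤-reflexive; ≤-trans; ≤-antisym; ≤-pred; n≤0⇒n≡0; n≤1+n; 1+n≰n; m≤m+n; m≤n+m;
         m≤n⇒m≤1+n; m≤n⇒m<n∨m≡n; ≮⇒≥; ≰⇒>; <⇒≱; <⇒≤; <⇒≢; suc-injective;
         +-suc; +-comm; +-assoc; +-identityʳ; +-mono-≤; +-monoˡ-≤; +-monoʳ-≤; +-monoʳ-<;
         +-cancelˡ-≤; +-cancelˡ-<; *-comm; *-distribˡ-+; *-mono-≤; *-monoʳ-≤; *-cancelˡ-≤;
         m+[n∸m]≡n; m∸n+n≡m; module ≤-Reasoning)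
  renaming (<-cmp to <-cmpⁿ)
open import Data.Nat.Tactic.RingSolver using (solve-∀)
open import Data.Product using (_×_; _,_; Σ; ∃; ∃₂; proj₁; proj₂)
import Data.Product.Properties as Product
open import Data.Sum using (_⊎_; inj₁; inj₂; fromInj₁; fromInj₂)
open import Function.Base using (_∘_; id)
open import Relation.Binary using (tri<; tri≈; tri>)
open import Relation.Binary.PropositionalEquality
  using (_≡_; _≢_; refl; cong; cong₂; subst; subst₂; trans) renaming (sym to ≡-sym)
open import Relation.Nullary using (¬_; Dec; yes; no)
open import Relation.Nullary.Decidable using (¬?; _×-dec_; _⊎-dec_; _→-dec_)

-- Counting with duplicate-free lists

_∈ᶠ?_ : ∀ {n} (x : Fin n) (xs : List (Fin n)) → Dec (x ∈ xs)
_∈ᶠ?_ = DecMembership._∈?_ _≟_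

unique-⊆⇒length≤ : ∀ {A : Set} {xs ys : List A} → Unique xs → xs ⊆ ys → length xs ≤ length ys
unique-⊆⇒length≤ [] _ = z≤n
unique-⊆⇒length≤ {xs = x ∷ xs} (x∉xs ∷ uxs) sub with ∈-∃++ (sub (here refl))
... | as , bs , refl = begin
  suc (length xs)              ≤⟨ s≤s (unique-⊆⇒length≤ uxs sub′) ⟩
  suc (length (as ++ bs))      ≡⟨ cong suc (length-++ as) ⟩
  suc (length as + length bs)  ≡⟨ +-suc (length as) (length bs) ⟨
  length as + length (x ∷ bs)  ≡⟨ length-++ as ⟨
  length (as ++ x ∷ bs)        ∎
  where
  open ≤-Reasoning
  sub′ : xs ⊆ as ++ bs
  sub′ z∈xs with ∈-++⁻ as (sub (there z∈xs))
  ... | inj₁ z∈as         = ∈-++⁺ˡ z∈as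
  ... | inj₂ (here refl)  = ⊥-elim (All.lookup x∉xs z∈xs refl)
  ... | inj₂ (there z∈bs) = ∈-++⁺ʳ as z∈bs

unique-∷ : ∀ {A : Set} {x : A} {xs} → x ∉ xs → Unique xs → Unique (x ∷ xs)
unique-∷ x∉xs uxs = ¬Any⇒All¬ _ x∉xs ∷ uxs

length-allFin : ∀ n → length (allFin n) ≡ n
length-allFin n = length-tabulate id

unique⇒length≤ : ∀ {n} {xs : List (Fin n)} → Unique xs → length xs ≤ n
unique⇒length≤ {n} uxs =
  ≤-trans (unique-⊆⇒length≤ uxs (λ {x} _ → ∈-allFin x)) (≤-reflexive (length-allFin n))

-- Growing a graph from a root

module _ {p : ℕ} (H : Graph p) where

  private
    V = Fin p
    E = V × V

  -- The index g is the cyclomatic number of the subgraph with vertices vs and edges es.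
  -- Edges added by grow are directed away from the root; the edge ab that closes the cycle
  -- must join two vertices that do not have children yet.
  data Growth : ℕ → List V → List E → Set where
    root  : ∀ u → Growth 0 [ u ] []
    grow  : ∀ {g vs es u v} → u ∈ vs → v ∉ vs → Adj H u v →
            Growth g vs es → Growth g (v ∷ vs) ((u , v) ∷ es)
    close : ∀ {vs es a b} → a ∈ vs → b ∈ vs → Adj H a b →
            (∀ {x y} → (x , y) ∈ es → x ≢ a × x ≢ b) →
            Growth 0 vs es → Growth 1 vs ((a , b) ∷ es)

  adj-sym : ∀ {u v} → Adj H u v → Adj H v u
  adj-sym {u} {v} = subst T (Graph.sym H u v)

  adj⇒≢ : ∀ {u v} → Adj H u v → u ≢ v
  adj⇒≢ {u} uv refl = subst T (irref H u) uv

  growth-edge : ∀ {g vs es} → Growth g vs es →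
                ∀ {x y} → (x , y) ∈ es → x ∈ vs × y ∈ vs × Adj H x y
  growth-edge (grow u∈ v∉ uv G) (here refl) = there u∈ , here refl , uv
  growth-edge (grow u∈ v∉ uv G) (there e∈) with growth-edge G e∈
  ... | x∈ , y∈ , xy = there x∈ , there y∈ , xy
  growth-edge (close a∈ b∈ ab _ G) (here refl) = a∈ , b∈ , ab
  growth-edge (close a∈ b∈ ab _ G) (there e∈) = growth-edge G e∈

  growth-unique : ∀ {g vs es} → Growth g vs es → Unique vs
  growth-unique (root u)          = [] ∷ []
  growth-unique (grow u∈ v∉ uv G) = unique-∷ v∉ (growth-unique G)
  growth-unique (close _ _ _ _ G) = growth-unique G

  growth-length : ∀ {g vs es} → Growth g vs es → suc (length es) ≡ g + length vs
  growth-length (root u)              = refl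
  growth-length {g} (grow {vs = vs} u∈ v∉ uv G) =
    trans (cong suc (growth-length G)) (≡-sym (+-suc g (length vs)))
  growth-length (close _ _ _ _ G)     = cong suc (growth-length G)

  -- The orientation that `edgeList` uses. It lets edges directed away from the root be counted
  -- against `numEdges`.
  norm : E → E
  norm (u , v) with u Fin.<? v
  ... | yes _ = u , v
  ... | no  _ = v , u

  norm-cases : ∀ e → norm e ≡ e ⊎ norm e ≡ (proj₂ e , proj₁ e)
  norm-cases (u , v) with u Fin.<? v
  ... | yes _ = inj₁ refl
  ... | no  _ = inj₂ refl

  norm-injective : ∀ {u v x y} → norm (u , v) ≡ norm (x , y) → (u , v) ≡ (x , y) ⊎ (v , u) ≡ (x , y)
  norm-injective {u} {v} {x} {y} eq with norm-cases (u , v) | norm-cases (x , y)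
  ... | inj₁ p | inj₁ q = inj₁ (trans (≡-sym p) (trans eq q))
  ... | inj₂ p | inj₁ q = inj₂ (trans (≡-sym p) (trans eq q))
  ... | inj₁ p | inj₂ q with trans (≡-sym p) (trans eq q)
  ...   | refl = inj₂ refl
  norm-injective {u} {v} {x} {y} eq | inj₂ p | inj₂ q with trans (≡-sym p) (trans eq q)
  ...   | refl = inj₁ refl

  norm∈edgeList : ∀ {u v} → Adj H u v → norm (u , v) ∈ edgeList H
  norm∈edgeList {u} {v} uv with u Fin.<? v
  ... | yes u<v = ∈-filter⁺ _ (∈-cartesianProduct⁺ (∈-allFin u) (∈-allFin v)) (u<v , uv)
  ... | no  u≮v = ∈-filter⁺ _ (∈-cartesianProduct⁺ (∈-allFin v) (∈-allFin u)) (v<u , adj-sym uv)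
    where
    v<u : v Fin.< u
    v<u with <-cmp u v
    ... | tri< u<v _ _  = ⊥-elim (u≮v u<v)
    ... | tri≈ _ u≡v _  = ⊥-elim (adj⇒≢ uv u≡v)
    ... | tri> _ _ v<u′ = v<u′

  -- A grown edge has an endpoint outside the earlier vertices, so it repeats no earlier edge in
  -- either orientation. The closing edge is new because neither of its endpoints is a tail.
  norm-unique : ∀ {g vs es} → Growth g vs es → Unique (map norm es)
  norm-unique (root u) = []
  norm-unique (grow {es = es} {u} {v} u∈ v∉ uv G) = unique-∷ new (norm-unique G)
    where
    new : norm (u , v) ∉ map norm es
    new m with ∈-map⁻ norm m
    ... | (x , y) , e∈ , eq with growth-edge G e∈ | norm-injective eq
    ...   | x∈ , y∈ , _ | inj₁ refl = v∉ y∈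
    ...   | x∈ , y∈ , _ | inj₂ refl = v∉ x∈
  norm-unique (close {es = es} {a} {b} a∈ b∈ ab notail G) = unique-∷ new (norm-unique G)
    where
    new : norm (a , b) ∉ map norm es
    new m with ∈-map⁻ norm m
    ... | (x , y) , e∈ , eq with norm-injective eq
    ...   | inj₁ refl = proj₁ (notail e∈) refl
    ...   | inj₂ refl = proj₂ (notail e∈) refl

  -- An edge of `H` missing from `es` would give `numEdges H` at least `length es + 1`. But if all
  -- vertices are reached, `growth-length` and the cyclomatic number allow at most `length es`
  -- edges.
  growth-covers : ∀ {g vs es} → Growth g vs es → (∀ x → x ∈ vs) → HasCyclomaticNumber H g →
                  ∀ {u v} → Adj H u v → (u , v) ∈ es ⊎ (v , u) ∈ es
  growth-covers {g} {vs} {es} G full cyc {u} {v} uv with norm (u , v) ∈? map norm es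
    where open DecMembership (Product.≡-dec _≟_ _≟_) using (_∈?_)
  ... | yes m with ∈-map⁻ norm m
  ...   | (x , y) , e∈ , eq with norm-injective eq
  ...     | inj₁ refl = inj₁ e∈
  ...     | inj₂ refl = inj₂ e∈
  growth-covers {g} {vs} {es} G full cyc {u} {v} uv | no new = ⊥-elim (1+n≰n (begin
    suc (suc (length es))  ≤⟨ s≤s gap ⟩
    suc (numEdges H)       ≡⟨ +-comm (numEdges H) 1 ⟨
    numEdges H + 1         ≡⟨ cyc ⟩
    g + p                  ≤⟨ +-mono-≤ (≤-refl {g}) p≤ ⟩
    g + length vs          ≡⟨ growth-length G ⟨
    suc (length es)        ∎))
    where
    open ≤-Reasoning
    sub : norm (u , v) ∷ map norm es ⊆ edgeList H
    sub (here refl) = norm∈edgeList uv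
    sub (there m) with ∈-map⁻ norm m
    ... | (x , y) , e∈ , refl = norm∈edgeList (proj₂ (proj₂ (growth-edge G e∈)))
    gap : suc (length es) ≤ numEdges H
    gap = subst (λ l → suc l ≤ numEdges H) (length-map norm es)
                (unique-⊆⇒length≤ (unique-∷ new (norm-unique G)) sub)
    p≤ : p ≤ length vs
    p≤ = subst (_≤ length vs) (length-allFin p) (unique-⊆⇒length≤ (allFin⁺ p) (λ {x} _ → full x))

  walk-exit : ∀ {vs u w} → Walk H u w → u ∈ vs → w ∉ vs →
              ∃₂ λ x y → x ∈ vs × y ∉ vs × Adj H x y
  walk-exit here u∈ w∉ = ⊥-elim (w∉ u∈)
  walk-exit {vs} (step {v = v} uv W) u∈ w∉ with v ∈ᶠ? vs
  ... | yes v∈ = walk-exit W v∈ w∉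
  ... | no  v∉ = _ , _ , u∈ , v∉ , uv

  growth-nonempty : ∀ {g vs es} → Growth g vs es → ∃ (_∈ vs)
  growth-nonempty (root u)           = _ , here refl
  growth-nonempty (grow u∈ _ _ _)    = _ , there u∈
  growth-nonempty (close a∈ _ _ _ _) = _ , a∈

  -- A walk from a reached vertex to a missing one leaves `vs` along an edge that `grow` accepts.
  -- Fuel `p` suffices, since each round adds a vertex and the vertices stay distinct.
  growth-complete : Connected H → ∀ {g} {vs : List V} {es : List E} → Growth g vs es →
                    ∃₂ λ vs′ es′ → Growth g vs′ es′ × (∀ x → x ∈ vs′)
  growth-complete conn {g} {vs} G = go p G (≤-trans (m≤m+n p _) (≤-reflexive (+-comm p _)))
    where
    go : ∀ k {vs : List V} {es : List E} → Growth g vs es → p ≤ length vs + k →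
         ∃₂ λ vs′ es′ → Growth g vs′ es′ × (∀ x → x ∈ vs′)
    go k {vs} G p≤ with any? {n = p} (λ x → ¬? (x ∈ᶠ? vs))
    ... | no  none = _ , _ , G , full
      where
      full : ∀ x → x ∈ vs
      full x with x ∈ᶠ? vs
      ... | yes x∈ = x∈
      ... | no  x∉ = ⊥-elim (none (x , x∉))
    go zero {vs} G p≤ | yes (x , x∉) =
      ⊥-elim (<⇒≱ (unique⇒length≤ (unique-∷ x∉ (growth-unique G))) (subst (p ≤_) (+-identityʳ _) p≤))
    go (suc k) {vs} G p≤ | yes (x , x∉) with growth-nonempty G
    ... | r , r∈ with walk-exit (conn r x) r∈ x∉
    ...   | _ , _ , u∈ , v∉ , uv = go k (grow u∈ v∉ uv G) (subst (p ≤_) (+-suc _ k) p≤)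

  -- Growing a cycle of length `k + 2` in two arms

  module _ (h : ℕ → V) {k : ℕ} (1≤k : 1 ≤ k)
           (h-inj : ∀ {i j} → i ≤ suc k → j ≤ suc k → h i ≡ h j → i ≡ j)
           (h-adj : ∀ i → Adj H (h i) (h (suc i))) (h-period : h (suc (suc k)) ≡ h 0) where

    private
      -- One arm is the single edge from `h 0` to `h (suc k)`, the other runs from `h 0` to `h i`.
      -- All tails are some `h j` with `j < k`, so the edge between `h k` and `h (suc k)` may close
      -- the cycle.
      PathGrowth : ℕ → Set
      PathGrowth i = ∃₂ λ vs es → Growth 0 vs es × h i ∈ vs × h (suc k) ∈ vs ×
        (∀ {x} → x ∈ vs → x ≡ h (suc k) ⊎ ∃ λ j → j ≤ i × x ≡ h j) ×
        (∀ {x y} → (x , y) ∈ es → ∃ λ j → j < k × x ≡ h j)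

      path-growth : ∀ i → i ≤ k → PathGrowth i
      path-growth zero _ =
        _ , _ , grow (here refl) new last-first (root (h 0)) , there (here refl) , here refl ,
        (λ { (here refl) → inj₁ refl ; (there (here refl)) → inj₂ (0 , z≤n , refl) }) ,
        -- The tail `h 0` of the short arm differs from `h k` because `k` is positive.
        (λ { (here refl) → 0 , 1≤k , refl })
        where
        last-first : Adj H (h 0) (h (suc k))
        last-first = adj-sym (subst (Adj H (h (suc k))) h-period (h-adj (suc k)))
        new : h (suc k) ∉ [ h 0 ]
        new (here eq) with () ← h-inj ≤-refl z≤n eq
      path-growth (suc i) i<k with path-growth i (<⇒≤ i<k)
      ... | vs , es , G , hi∈ , last∈ , onPath , tails =
        _ , _ , grow hi∈ new (h-adj i) G , here refl , there last∈ ,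
        (λ { (here refl) → inj₂ (suc i , ≤-refl , refl)
           ; (there x∈) → weaken (onPath x∈) }) ,
        (λ { (here refl) → i , i<k , refl ; (there e∈) → tails e∈ })
        where
        weaken : ∀ {x} → x ≡ h (suc k) ⊎ (∃ λ j → j ≤ i × x ≡ h j) →
                 x ≡ h (suc k) ⊎ ∃ λ j → j ≤ suc i × x ≡ h j
        weaken (inj₁ eq)            = inj₁ eq
        weaken (inj₂ (j , j≤ , eq)) = inj₂ (j , m≤n⇒m≤1+n j≤ , eq)
        new : h (suc i) ∉ vs
        new m with onPath m
        ... | inj₁ eq = <⇒≢ (s≤s i<k) (h-inj (m≤n⇒m≤1+n i<k) ≤-refl eq)
        ... | inj₂ (j , j≤ , eq) =
          <⇒≢ (s≤s j≤) (≡-sym (h-inj (m≤n⇒m≤1+n i<k) (≤-trans j≤ (≤-trans (<⇒≤ i<k) (n≤1+n k))) eq))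

    cycle-growth : ∃₂ (Growth 1)
    cycle-growth with path-growth k ≤-refl
    ... | vs , es , G , hk∈ , last∈ , _ , tails = _ , _ , close hk∈ last∈ (h-adj k) untailed G
      where
      untailed : ∀ {x y} → (x , y) ∈ es → x ≢ h k × x ≢ h (suc k)
      untailed e∈ with tails e∈
      ... | j , j<k , refl =
        (λ eq → <⇒≢ j<k (h-inj (≤-trans (<⇒≤ j<k) (n≤1+n k)) (n≤1+n k) eq)) ,
        (λ eq → <⇒≢ (m≤n⇒m≤1+n j<k) (h-inj (≤-trans (<⇒≤ j<k) (n≤1+n k)) ≤-refl eq))

-- Cycles as periodic sequences

toℕ-cycNext : ∀ {k} (i : Fin (suc k)) → toℕ i < k → toℕ (cycNext i) ≡ suc (toℕ i)
toℕ-cycNext {k} i i<k with toℕ i <? k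
... | yes i<k′ = cong suc (toℕ-fromℕ< i<k′)
... | no  i≮k  = ⊥-elim (i≮k i<k)

cycNext-last : ∀ {k} (i : Fin (suc k)) → toℕ i ≡ k → cycNext i ≡ Fin.zero
cycNext-last {k} i i≡k with toℕ i <? k
... | yes i<k = ⊥-elim (<⇒≢ i<k i≡k)
... | no  _   = refl

-- Iterating `cycNext` makes every edge of the cycle, including the last one, a pair of consecutive
-- terms, so that wrapping around needs no separate case.
around : ∀ {k} → ℕ → Fin (suc k)
around zero    = Fin.zero
around (suc i) = cycNext (around i)

toℕ-around : ∀ {k} i → i ≤ k → toℕ (around {k} i) ≡ i
toℕ-around zero    _   = refl
toℕ-around {k} (suc i) i<k =
  trans (toℕ-cycNext (around i) (subst (_< k) (≡-sym eq) i<k)) (cong suc eq)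
  where
  eq : toℕ (around {k} i) ≡ i
  eq = toℕ-around i (<⇒≤ i<k)

around-period : ∀ k → around {k} (suc k) ≡ Fin.zero
around-period k = cycNext-last (around k) (toℕ-around k ≤-refl)

around-injective : ∀ {k i j} → i ≤ k → j ≤ k → around {k} i ≡ around j → i ≡ j
around-injective i≤ j≤ eq = trans (≡-sym (toℕ-around _ i≤)) (trans (cong toℕ eq) (toℕ-around _ j≤))

-- Greedy rainbow embeddings

module _ {n t : ℕ} (χ : Colouring n t) where

  private
    c = col χ

  Appears : List (Fin n) → Fin t → Set
  Appears S a = Any (λ i → Any (λ j → i ≢ j × c i j ≡ a) S) S

  -- Without `Appears`, every colour absent from `S` would vacuously be private to every vertex.
  Private : List (Fin n) → Fin n → Fin t → Set
  Private S u a = Appears S a × All (λ i → All (λ j → i ≢ j → c i j ≡ a → i ≡ u ⊎ j ≡ u) S) S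

  appears? : ∀ S a → Dec (Appears S a)
  appears? S a = Any.any? (λ i → Any.any? (λ j → ¬? (i ≟ j) ×-dec (c i j ≟ a)) S) S

  private? : ∀ S u a → Dec (Private S u a)
  private? S u a = appears? S a ×-dec
    All.all? (λ i → All.all? (λ j → ¬? (i ≟ j) →-dec ((c i j ≟ a) →-dec ((i ≟ u) ⊎-dec (j ≟ u)))) S) S

  appears⁺ : ∀ {S i j a} → i ∈ S → j ∈ S → i ≢ j → c i j ≡ a → Appears S a
  appears⁺ i∈ j∈ i≢j eq = lose i∈ (lose j∈ (i≢j , eq))

  appears⁻ : ∀ {S a} → Appears S a → ∃₂ λ i j → i ∈ S × j ∈ S × i ≢ j × c i j ≡ a
  appears⁻ ap with find ap
  ... | i , i∈ , rest with find rest
  ...   | j , j∈ , i≢j , eq = i , j , i∈ , j∈ , i≢j , eq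

  private⁻ : ∀ {S u a} → Private S u a → ∀ {i j} → i ∈ S → j ∈ S → i ≢ j → c i j ≡ a → i ≡ u ⊎ j ≡ u
  private⁻ (_ , all) i∈ j∈ = All.lookup (All.lookup all i∈) j∈

  private-star : ∀ {S u a} → Private S u a → ∃ λ y → y ∈ S × y ≢ u × c u y ≡ a
  private-star pr@(ap , _) with appears⁻ ap
  ... | i , j , i∈ , j∈ , i≢j , eq with private⁻ pr i∈ j∈ i≢j eq
  ...   | inj₁ refl = j , j∈ , i≢j ∘ ≡-sym , eq
  ...   | inj₂ refl = i , i∈ , i≢j , trans (csym χ j i) eq

  colours : List (Fin n) → List (Fin t)
  colours S = filter (appears? S) (allFin t)

  privateColours : List (Fin n) → Fin n → List (Fin t)
  privateColours S u = filter (private? S u) (allFin t)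

  -- The last component looks only at edges from `u` into `us`: when `us` lies in `S`, its other
  -- edges avoid `u` and cannot have the private colour `c u y`.
  Fresh : List (Fin n) → List (Fin n) → Fin n → Fin n → Set
  Fresh S us u y = y ∉ us × y ≢ u × Private S u (c u y) × All (λ z → z ≢ u → c u y ≢ c u z) us

  fresh? : ∀ S us u y → Dec (Fresh S us u y)
  fresh? S us u y = ¬? (y ∈ᶠ? us) ×-dec ¬? (y ≟ u) ×-dec private? S u (c u y) ×-dec
    All.all? (λ z → ¬? (z ≟ u) →-dec ¬? (c u y ≟ c u z)) us

  -- If no neighbour were fresh, every colour private to u would occur on an edge from u to
  -- some other vertex of us.
  fresh-exists : ∀ {S us u} → u ∈ us → length us ≤ length (privateColours S u) →
                 ∃ λ y → y ∈ S × Fresh S us u y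
  fresh-exists {S} {us} {u} u∈us deg with Any.any? (fresh? S us u) S
  ... | yes some = find some
  ... | no  none = ⊥-elim (<⇒≱ fewer (≤-trans deg (subst (length (privateColours S u) ≤_)
      (length-map (c u) others) (unique-⊆⇒length≤ (filter⁺ (private? S u) (allFin⁺ t)) covered))))
    where
    others : List (Fin n)
    others = filter (λ z → ¬? (z ≟ u)) us

    -- `u` is itself a used vertex but is joined to no copy of itself, which makes the count strict.
    fewer : length others < length us
    fewer = filter-notAll (λ z → ¬? (z ≟ u)) us (Any.map (λ u≡z z≢u → z≢u (≡-sym u≡z)) u∈us)

    covered : privateColours S u ⊆ map (c u) others
    covered {a} a∈ with proj₂ (∈-filter⁻ (private? S u) {xs = allFin t} a∈)
    ... | pr with private-star pr
    ... | y , y∈S , y≢u , refl with y ∈ᶠ? us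
    ... | yes y∈us = ∈-map⁺ (c u) (∈-filter⁺ (λ z → ¬? (z ≟ u)) y∈us y≢u)
    ... | no  y∉us with Any.any? (λ z → ¬? (z ≟ u) ×-dec (c u y ≟ c u z)) us
    ... | no  distinct = ⊥-elim (none (lose y∈S
            (y∉us , y≢u , pr , All.map (λ ¬q z≢u eq → ¬q (z≢u , eq)) (¬Any⇒All¬ us distinct))))
    ... | yes some with find some
    ... | z , z∈us , z≢u , eq =
      subst (_∈ map (c u) others) (≡-sym eq) (∈-map⁺ (c u) (∈-filter⁺ (λ z → ¬? (z ≟ u)) z∈us z≢u))

  -- Embedding a growth where all vertices have many private colours

  module _ {p : ℕ} (H : Graph p) (S : List (Fin n))
           (rich : ∀ {u} → u ∈ S → p ≤ suc (length (privateColours S u))) where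

    private
      edgeColour : (Fin p → Fin n) → Fin p × Fin p → Fin t
      edgeColour f (x , y) = c (f x) (f y)

    -- Only the values of `f` on `vs` matter. `outwards` is kept just until the cycle is closed,
    -- which is where it is used; the colour of the closing edge need not be private to an endpoint.
    record Embedding (g : ℕ) (vs : List (Fin p)) (es : List (Fin p × Fin p)) : Set where
      field
        f        : Fin p → Fin n
        into     : ∀ {x} → x ∈ vs → f x ∈ S
        inj      : ∀ {x y} → x ∈ vs → y ∈ vs → f x ≡ f y → x ≡ y
        rainbow  : ∀ {e e′} → e ∈ es → e′ ∈ es → edgeColour f e ≡ edgeColour f e′ → e ≡ e′
        outwards : g ≡ 0 → ∀ {x y} → (x , y) ∈ es → Private S (f x) (c (f x) (f y))

    growth-embedding : ∃ (_∈ S) → ∀ {g vs es} → Growth H g vs es → Embedding g vs es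
    growth-embedding (s , s∈) (root u) = record
      { f        = λ _ → s
      ; into     = λ _ → s∈
      ; inj      = λ { (here refl) (here refl) _ → refl }
      ; rainbow  = λ ()
      ; outwards = λ _ ()
      }
    growth-embedding s∈S (close {vs} {es} {a} {b} a∈ b∈ ab untailed G) = record
      { f        = f
      ; into     = into
      ; inj      = inj
      ; rainbow  = rainbow′
      ; outwards = λ ()
      }
      where
      open Embedding (growth-embedding s∈S G)

      closing-new : ∀ {x y} → (x , y) ∈ es → c (f a) (f b) ≢ c (f x) (f y)
      closing-new e∈ eq with growth-edge H G e∈
      ... | x∈ , y∈ , xy with private⁻ (outwards refl e∈) (into a∈) (into b∈)
                                 (λ fa≡fb → adj⇒≢ H ab (inj a∈ b∈ fa≡fb)) eq
      ... | inj₁ fa≡fx = proj₁ (untailed e∈) (≡-sym (inj a∈ x∈ fa≡fx))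
      ... | inj₂ fb≡fx = proj₂ (untailed e∈) (≡-sym (inj b∈ x∈ fb≡fx))

      rainbow′ : ∀ {e e′} → e ∈ (a , b) ∷ es → e′ ∈ (a , b) ∷ es →
                 edgeColour f e ≡ edgeColour f e′ → e ≡ e′
      rainbow′ (here refl) (here refl) _  = refl
      rainbow′ (here refl) (there e∈)  eq = ⊥-elim (closing-new e∈ eq)
      rainbow′ (there e∈)  (here refl) eq = ⊥-elim (closing-new e∈ (≡-sym eq))
      rainbow′ (there e∈)  (there e∈′) eq = rainbow e∈ e∈′ eq
    growth-embedding s∈S (grow {g} {vs} {es} {u} {v} u∈ v∉ uv G) =
      extend (fresh-exists (∈-map⁺ f u∈) room)
      where
      open Embedding (growth-embedding s∈S G)

      -- As `v` is still missing from `vs`, at most `p - 1` vertices are in use, and `rich` provides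
      -- as many private colours.
      room : length (map f vs) ≤ length (privateColours S (f u))
      room = ≤-pred (begin
        suc (length (map f vs))                ≡⟨ cong suc (length-map f vs) ⟩
        length (v ∷ vs)                        ≤⟨ unique⇒length≤ (unique-∷ v∉ (growth-unique H G)) ⟩
        p                                      ≤⟨ rich (into u∈) ⟩
        suc (length (privateColours S (f u)))  ∎)
        where open ≤-Reasoning

      extend : (∃ λ y → y ∈ S × Fresh S (map f vs) (f u) y) →
               Embedding g (v ∷ vs) ((u , v) ∷ es)
      extend (w , w∈ , w∉ , w≢ , pr , distinct) = record
        { f        = f′
        ; into     = into′
        ; inj      = inj′
        ; rainbow  = rainbow′
        ; outwards = outwards′
        }
        where
        f′ : Fin p → Fin n
        f′ x with x ≟ v
        ... | yes _ = w
        ... | no  _ = f x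

        f′-new : f′ v ≡ w
        f′-new with v ≟ v
        ... | yes _  = refl
        ... | no v≢v = ⊥-elim (v≢v refl)

        f′-old : ∀ {x} → x ∈ vs → f′ x ≡ f x
        f′-old {x} x∈ with x ≟ v
        ... | yes refl = ⊥-elim (v∉ x∈)
        ... | no  _    = refl

        into′ : ∀ {x} → x ∈ v ∷ vs → f′ x ∈ S
        into′ (here refl) = subst (_∈ S) (≡-sym f′-new) w∈
        into′ (there x∈)  = subst (_∈ S) (≡-sym (f′-old x∈)) (into x∈)

        new≢old : ∀ {x} → x ∈ vs → f′ v ≢ f′ x
        new≢old {x} x∈ eq = w∉ (subst (_∈ map f vs)
          (trans (≡-sym (f′-old x∈)) (trans (≡-sym eq) f′-new)) (∈-map⁺ f x∈))

        inj′ : ∀ {x y} → x ∈ v ∷ vs → y ∈ v ∷ vs → f′ x ≡ f′ y → x ≡ y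
        inj′ (here refl) (here refl) _  = refl
        inj′ (here refl) (there y∈)  eq = ⊥-elim (new≢old y∈ eq)
        inj′ (there x∈)  (here refl) eq = ⊥-elim (new≢old x∈ (≡-sym eq))
        inj′ (there x∈)  (there y∈)  eq = inj x∈ y∈ (trans (≡-sym (f′-old x∈)) (trans eq (f′-old y∈)))

        newColour : edgeColour f′ (u , v) ≡ c (f u) w
        newColour = cong₂ c (f′-old u∈) f′-new

        oldColour : ∀ {e} → e ∈ es → edgeColour f′ e ≡ edgeColour f e
        oldColour {x , y} e∈ with growth-edge H G e∈
        ... | x∈ , y∈ , _ = cong₂ c (f′-old x∈) (f′-old y∈)

        -- Being private to `f u`, the colour can recur only on an edge at `f u`. Such an old edge
        -- leads to a used vertex, where `distinct` forbids it.
        fresh-colour : ∀ {e} → e ∈ es → c (f u) w ≢ edgeColour f e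
        fresh-colour {x , y} e∈ eq with growth-edge H G e∈
        ... | x∈ , y∈ , xy with private⁻ pr (into x∈) (into y∈) fx≢fy (≡-sym eq)
          where
          fx≢fy : f x ≢ f y
          fx≢fy = adj⇒≢ H xy ∘ inj x∈ y∈
        ... | inj₁ fx≡fu = All.lookup distinct (∈-map⁺ f y∈)
                (λ fy≡fu → adj⇒≢ H xy (inj x∈ y∈ (trans fx≡fu (≡-sym fy≡fu))))
                (trans eq (cong (λ z → c z (f y)) fx≡fu))
        ... | inj₂ fy≡fu = All.lookup distinct (∈-map⁺ f x∈)
                (λ fx≡fu → adj⇒≢ H xy (inj x∈ y∈ (trans fx≡fu (≡-sym fy≡fu))))
                (trans eq (trans (csym χ (f x) (f y)) (cong (λ z → c z (f x)) fy≡fu)))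

        rainbow′ : ∀ {e e′} → e ∈ (u , v) ∷ es → e′ ∈ (u , v) ∷ es →
                   edgeColour f′ e ≡ edgeColour f′ e′ → e ≡ e′
        rainbow′ (here refl) (here refl) _  = refl
        rainbow′ (here refl) (there e∈)  eq =
          ⊥-elim (fresh-colour e∈ (trans (≡-sym newColour) (trans eq (oldColour e∈))))
        rainbow′ (there e∈)  (here refl) eq =
          ⊥-elim (fresh-colour e∈ (trans (≡-sym newColour) (trans (≡-sym eq) (oldColour e∈))))
        rainbow′ (there e∈)  (there e∈′) eq =
          rainbow e∈ e∈′ (trans (≡-sym (oldColour e∈)) (trans eq (oldColour e∈′)))

        outwards′ : g ≡ 0 → ∀ {x y} → (x , y) ∈ (u , v) ∷ es → Private S (f′ x) (c (f′ x) (f′ y))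
        outwards′ g≡0 (here refl) rewrite f′-old u∈ | f′-new = pr
        outwards′ g≡0 (there e∈) with growth-edge H G e∈
        ... | x∈ , y∈ , _ rewrite f′-old x∈ | f′-old y∈ = outwards g≡0 e∈

    -- By `growth-covers` each edge of `H` lies in `es` in one of its orientations. `csym` turns
    -- both edges into that orientation, whence the four cases.
    embedding⇒rainbowCopy : ∀ {g vs es} → Growth H g vs es → (∀ x → x ∈ vs) →
                            HasCyclomaticNumber H g → Embedding g vs es → RainbowCopy χ H
    embedding⇒rainbowCopy {es = es} G full cyc emb = f , inj (full _) (full _) , distinct
      where
      open Embedding emb
      distinct : ∀ u v u′ v′ → Adj H u v → Adj H u′ v′ → c (f u) (f v) ≡ c (f u′) (f v′) →
                 (u ≡ u′ × v ≡ v′) ⊎ (u ≡ v′ × v ≡ u′)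
      distinct u v u′ v′ uv uv′ eq
        with growth-covers H G full cyc uv | growth-covers H G full cyc uv′
      ... | inj₁ e | inj₁ e′ with refl ← rainbow e e′ eq = inj₁ (refl , refl)
      ... | inj₁ e | inj₂ e′ with refl ← rainbow e e′ (trans eq (csym χ _ _)) = inj₂ (refl , refl)
      ... | inj₂ e | inj₁ e′ with refl ← rainbow e e′ (trans (csym χ _ _) eq) = inj₂ (refl , refl)
      ... | inj₂ e | inj₂ e′
        with refl ← rainbow e e′ (trans (csym χ _ _) (trans eq (csym χ _ _))) = inj₁ (refl , refl)

  -- Counting colours while deleting vertices

  colours-∪ : ∀ {P Q : Fin t → Set} (P? : ∀ a → Dec (P a)) (Q? : ∀ a → Dec (Q a)) S →
                    (∀ {a} → Appears S a → P a ⊎ Q a) →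
                    length (colours S) ≤
                    length (filter P? (allFin t)) + length (filter Q? (allFin t))
  colours-∪ P? Q? S split = ≤-trans
    (unique-⊆⇒length≤ (filter⁺ (appears? S) (allFin⁺ t)) sub)
    (≤-reflexive (length-++ (filter P? (allFin t))))
    where
    sub : colours S ⊆ filter P? (allFin t) ++ filter Q? (allFin t)
    sub {a} a∈ with split (proj₂ (∈-filter⁻ (appears? S) {xs = allFin t} a∈))
    ... | inj₁ pa = ∈-++⁺ˡ (∈-filter⁺ P? (∈-allFin a) pa)
    ... | inj₂ qa = ∈-++⁺ʳ (filter P? (allFin t)) (∈-filter⁺ Q? (∈-allFin a) qa)

  -- A colour that disappears with `u` occurs only on edges through `u`, hence is private to `u`.
  colours-remove : ∀ as u bs → length (colours (as ++ u ∷ bs)) ≤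
                   length (colours (as ++ bs)) + length (privateColours (as ++ u ∷ bs) u)
  colours-remove as u bs = colours-∪ (appears? (as ++ bs)) (private? (as ++ u ∷ bs) u) _ split
    where
    survives : ∀ {x} → x ∈ as ++ u ∷ bs → x ≢ u → x ∈ as ++ bs
    survives x∈ x≢u with ∈-++⁻ as x∈
    ... | inj₁ x∈as         = ∈-++⁺ˡ x∈as
    ... | inj₂ (here x≡u)   = ⊥-elim (x≢u x≡u)
    ... | inj₂ (there x∈bs) = ∈-++⁺ʳ as x∈bs

    split : ∀ {a} → Appears (as ++ u ∷ bs) a → Appears (as ++ bs) a ⊎ Private (as ++ u ∷ bs) u a
    split {a} ap with appears? (as ++ bs) a
    ... | yes ap′ = inj₁ ap′
    ... | no  ¬ap = inj₂ (ap , All.tabulate λ {i} i∈ → All.tabulate λ {j} j∈ → meets i∈ j∈)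
      where
      meets : ∀ {i j} → i ∈ as ++ u ∷ bs → j ∈ as ++ u ∷ bs → i ≢ j → c i j ≡ a → i ≡ u ⊎ j ≡ u
      meets {i} {j} i∈ j∈ i≢j eq with i ≟ u | j ≟ u
      ... | yes i≡u | _       = inj₁ i≡u
      ... | no  _   | yes j≡u = inj₂ j≡u
      ... | no  i≢u | no  j≢u = ⊥-elim (¬ap (appears⁺ (survives i∈ i≢u) (survives j∈ j≢u) i≢j eq))

  colours-∷ : ∀ v S → length (colours (v ∷ S)) ≤ length (colours S) + length S
  colours-∷ v S = subst (length (colours (v ∷ S)) ≤_)
    (trans (length-++ (colours S)) (cong (length (colours S) +_) (length-map (c v) S)))
    (unique-⊆⇒length≤ (filter⁺ (appears? (v ∷ S)) (allFin⁺ t)) sub)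
    where
    sub : colours (v ∷ S) ⊆ colours S ++ map (c v) S
    sub a∈ with appears⁻ (proj₂ (∈-filter⁻ (appears? (v ∷ S)) {xs = allFin t} a∈))
    ... | _ , _ , here refl , here refl , i≢j , _    = ⊥-elim (i≢j refl)
    ... | _ , _ , here refl , there j∈  , _   , refl = ∈-++⁺ʳ (colours S) (∈-map⁺ (c v) j∈)
    ... | i , _ , there i∈  , here refl , _   , refl =
      ∈-++⁺ʳ (colours S) (subst (_∈ map (c v) S) (csym χ v i) (∈-map⁺ (c v) i∈))
    ... | _ , _ , there i∈  , there j∈  , i≢j , eq   =
      ∈-++⁺ˡ (∈-filter⁺ (appears? S) (∈-allFin _) (appears⁺ i∈ j∈ i≢j eq))

  -- There are no more colours than edges: this is the bound by `length S` choose 2, doubled and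
  -- cleared of subtraction. Each further vertex brings at most one new colour per edge to its
  -- predecessors.
  colours-bound : ∀ S → 2 * length (colours S) + length S ≤ length S * length S
  colours-bound [] = ≤-reflexive (trans (+-identityʳ _) (cong (2 *_)
    (n≤0⇒n≡0 (unique-⊆⇒length≤ {ys = []} (filter⁺ (appears? []) (allFin⁺ t)) none))))
    where
    none : colours [] ⊆ []
    none a∈ with () ← proj₂ (∈-filter⁻ (appears? []) {xs = allFin t} a∈)
  colours-bound (v ∷ S) = begin
    2 * length (colours (v ∷ S)) + suc s  ≤⟨ +-monoˡ-≤ (suc s) (*-monoʳ-≤ 2 (colours-∷ v S)) ⟩
    2 * (d + s) + suc s                   ≡⟨ regroup d s ⟩
    (2 * d + s) + (s + suc s)             ≤⟨ +-monoˡ-≤ (s + suc s) (colours-bound S) ⟩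
    s * s + (s + suc s)                   ≡⟨ square s ⟩
    suc s * suc s                         ∎
    where
    open ≤-Reasoning
    s = length S
    d = length (colours S)
    regroup : ∀ d s → 2 * (d + s) + suc s ≡ (2 * d + s) + (s + suc s)
    regroup = solve-∀
    square : ∀ s → s * s + (s + suc s) ≡ suc s * suc s
    square = solve-∀

  -- With `p = 3 + q`, the hypothesis says that `S` carries at least `(p - 2) |S| - p (p - 3) / 2`
  -- colours. Deleting a vertex with at most `p - 2` private colours preserves it; if there is none,
  -- the greedy embedding applies. `k` counts the vertices beyond `p - 1`.
  many-colours⇒rainbowCopy :
    ∀ {q vs es} (H : Graph (3 + q)) → Growth H 1 vs es → (∀ x → x ∈ vs) → HasCyclomaticNumber H 1 →
    ∀ k S → length S ≡ k + (2 + q) →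
    2 * ((1 + q) * length S) ≤ 2 * length (colours S) + (3 + q) * q → RainbowCopy χ H
  many-colours⇒rainbowCopy {q} H G full cyc zero S |S| many = ⊥-elim (1+n≰n (begin
    -- On `p - 1` vertices the hypothesis demands one colour more than there are edges. After
    -- doubling the surplus is 2, of which 1 is enough.
    suc (((2 + q) * (2 + q)) + (3 + q) * q)                ≤⟨ m≤m+n _ 1 ⟩
    suc (((2 + q) * (2 + q)) + (3 + q) * q) + 1             ≡⟨ arithmetic q ⟩
    2 * ((1 + q) * (2 + q)) + (2 + q)                       ≡⟨ cong (λ s → 2 * ((1 + q) * s) + s) |S| ⟨
    2 * ((1 + q) * length S) + length S                     ≤⟨ +-monoˡ-≤ (length S) many ⟩
    2 * length (colours S) + (3 + q) * q + length S         ≡⟨ swapʳ (2 * length (colours S)) ((3 + q) * q) (length S) ⟩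
    2 * length (colours S) + length S + (3 + q) * q         ≤⟨ +-monoˡ-≤ ((3 + q) * q) (colours-bound S) ⟩
    length S * length S + (3 + q) * q                       ≡⟨ cong (λ s → s * s + (3 + q) * q) |S| ⟩
    (2 + q) * (2 + q) + (3 + q) * q                         ∎))
    where
    open ≤-Reasoning
    arithmetic : ∀ q → suc (((2 + q) * (2 + q)) + (3 + q) * q) + 1 ≡ 2 * ((1 + q) * (2 + q)) + (2 + q)
    arithmetic = solve-∀
    swapʳ : ∀ a b c → a + b + c ≡ a + c + b
    swapʳ = solve-∀
  many-colours⇒rainbowCopy {q} H G full cyc (suc k) S |S| many
    with Any.any? (λ u → length (privateColours S u) ≤? 1 + q) S
  ... | no none =
    embedding⇒rainbowCopy H S rich G full cyc (growth-embedding H S rich (nonempty S |S|) G)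
    where
    rich : ∀ {u} → u ∈ S → 3 + q ≤ suc (length (privateColours S u))
    rich u∈ = s≤s (≰⇒> (λ few → none (lose u∈ few)))
    nonempty : ∀ (S : List (Fin n)) → length S ≡ suc k + (2 + q) → ∃ (_∈ S)
    nonempty (x ∷ _) _ = x , here refl
  ... | yes some with find some
  ... | u , u∈ , few with ∈-∃++ u∈
  ... | as , bs , refl = many-colours⇒rainbowCopy H G full cyc k (as ++ bs)
    (suc-injective (trans (≡-sym longer) |S|))
    (+-cancelˡ-≤ (2 * (1 + q)) _ _ (begin
      2 * (1 + q) + 2 * ((1 + q) * length (as ++ bs))           ≡⟨ distrib (1 + q) (length (as ++ bs)) ⟩
      2 * ((1 + q) * suc (length (as ++ bs)))                   ≡⟨ cong (λ l → 2 * ((1 + q) * l)) longer ⟨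
      2 * ((1 + q) * length (as ++ u ∷ bs))                     ≤⟨ many ⟩
      2 * length (colours (as ++ u ∷ bs)) + (3 + q) * q
        ≤⟨ +-monoˡ-≤ ((3 + q) * q) (*-monoʳ-≤ 2 (≤-trans (colours-remove as u bs) (+-mono-≤ ≤-refl few))) ⟩
      2 * (length (colours (as ++ bs)) + (1 + q)) + (3 + q) * q ≡⟨ regroup (length (colours (as ++ bs))) (1 + q) _ ⟩
      2 * (1 + q) + (2 * length (colours (as ++ bs)) + (3 + q) * q) ∎))
    where
    open ≤-Reasoning
    longer : length (as ++ u ∷ bs) ≡ suc (length (as ++ bs))
    longer = trans (length-++ as) (trans (+-suc _ _) (cong suc (≡-sym (length-++ as))))
    distrib : ∀ a l → 2 * a + 2 * (a * l) ≡ 2 * (a * suc l)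
    distrib = solve-∀
    regroup : ∀ d a b → 2 * (d + a) + b ≡ 2 * a + (2 * d + b)
    regroup = solve-∀

  colours-allFin : length (colours (allFin n)) ≡ t
  colours-allFin = ≤-antisym
    (unique⇒length≤ (filter⁺ (appears? (allFin n)) (allFin⁺ t)))
    (subst (_≤ length (colours (allFin n))) (length-allFin t)
      (unique-⊆⇒length≤ (allFin⁺ t) λ {a} _ → ∈-filter⁺ (appears? (allFin n)) (∈-allFin a) (used a)))
    where
    used : ∀ a → Appears (allFin n) a
    used a with surj χ a
    ... | i , j , i≢j , eq = appears⁺ (∈-allFin i) (∈-allFin j) i≢j eq

-- Colourings without a rainbow cycle

RainbowCycle : ∀ {n} {C : Set} → ℕ → (Fin n → Fin n → C) → Set
RainbowCycle {n} K hue = Σ (ℕ → Fin n) λ h → h K ≡ h 0 ×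
  (∀ {i j} → i < K → j < K → h i ≡ h j → i ≡ j) ×
  (∀ {i j} → i < K → j < K → hue (h i) (h (suc i)) ≡ hue (h j) (h (suc j)) → i ≡ j)

-- Unlike Colouring n t, this is inhabited for n = 1 and t = 0: the values on the diagonal are
-- not required to be colours.
record Avoiding (K n t : ℕ) : Set where
  field
    hue     : Fin n → Fin n → ℕ
    hue-sym : ∀ i j → hue i j ≡ hue j i
    bound   : ∀ {i j} → i ≢ j → hue i j < t
    onto    : ∀ {a} → a < t → ∃₂ λ i j → i ≢ j × hue i j ≡ a
    acyclic : ¬ RainbowCycle K hue

no-long-cycle : ∀ {K n} {C : Set} {hue : Fin n → Fin n → C} → n < K → ¬ RainbowCycle K hue
no-long-cycle n<K (h , _ , inj , _) = <⇒≱ n<K (injective⇒≤ {f = h ∘ toℕ} λ {i} {j} eq →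
  toℕ-injective (inj (toℕ<n i) (toℕ<n j) eq))

-- A numbering of the edges from 0 on: first those avoiding the vertex zero, then the `n` edges at
-- zero. The diagonal value is a dummy.
completeHue : ∀ {n} → Fin n → Fin n → ℕ
completeHue Fin.zero            Fin.zero    = 0
completeHue {suc n} Fin.zero    (Fin.suc j) = n C 2 + toℕ j
completeHue {suc n} (Fin.suc i) Fin.zero    = n C 2 + toℕ i
completeHue (Fin.suc i)         (Fin.suc j) = completeHue i j

[1+n]C2≡nC2+n : ∀ n → suc n C 2 ≡ n C 2 + n
[1+n]C2≡nC2+n n = trans (≡-sym (nCk+nC[k+1]≡[n+1]C[k+1] n 1))
  (trans (cong (_+ n C 2) (nC1≡n n)) (+-comm n (n C 2)))

completeHue-sym : ∀ {n} (i j : Fin n) → completeHue i j ≡ completeHue j i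
completeHue-sym Fin.zero    Fin.zero    = refl
completeHue-sym Fin.zero    (Fin.suc j) = refl
completeHue-sym (Fin.suc i) Fin.zero    = refl
completeHue-sym (Fin.suc i) (Fin.suc j) = completeHue-sym i j

completeHue-bound : ∀ {n} {i j : Fin n} → i ≢ j → completeHue i j < n C 2
completeHue-bound {i = Fin.zero} {Fin.zero} i≢j = ⊥-elim (i≢j refl)
completeHue-bound {suc n} {Fin.zero} {Fin.suc j} _ =
  subst (n C 2 + toℕ j <_) (≡-sym ([1+n]C2≡nC2+n n)) (+-monoʳ-< (n C 2) (toℕ<n j))
completeHue-bound {suc n} {Fin.suc i} {Fin.zero} _ =
  subst (n C 2 + toℕ i <_) (≡-sym ([1+n]C2≡nC2+n n)) (+-monoʳ-< (n C 2) (toℕ<n i))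
completeHue-bound {suc n} {Fin.suc i} {Fin.suc j} i≢j =
  ≤-trans (completeHue-bound (i≢j ∘ cong Fin.suc))
          (subst (n C 2 ≤_) (≡-sym ([1+n]C2≡nC2+n n)) (m≤m+n (n C 2) n))

completeHue-onto : ∀ n {a} → a < n C 2 → ∃₂ λ (i j : Fin n) → i ≢ j × completeHue i j ≡ a
completeHue-onto (suc n) {a} a< with a <? n C 2
... | yes a<′ with completeHue-onto n a<′
...   | i , j , i≢j , eq = Fin.suc i , Fin.suc j , (λ { refl → i≢j refl }) , eq
completeHue-onto (suc n) {a} a< | no a≮ = Fin.zero , Fin.suc (fromℕ< b<n) , (λ ()) ,
  trans (cong (n C 2 +_) (toℕ-fromℕ< b<n)) (m+[n∸m]≡n (≮⇒≥ a≮))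
  where
  b<n : a ∸ n C 2 < n
  b<n = +-cancelˡ-< (n C 2) _ _ (subst (_< n C 2 + n) (≡-sym (m+[n∸m]≡n (≮⇒≥ a≮)))
          (subst (a <_) ([1+n]C2≡nC2+n n) a<))

complete : ∀ {K n} → n < K → Avoiding K n (n C 2)
complete n<K = record
  { hue     = completeHue
  ; hue-sym = completeHue-sym
  ; bound   = completeHue-bound
  ; onto    = completeHue-onto _
  ; acyclic = no-long-cycle {hue = completeHue} n<K
  }

-- A discrete intermediate value argument. It locates the edges on which a cycle passes between a
-- block and the rest.
change : ∀ (s : ℕ → Bool) i d → s i ≢ s (d + i) → ∃ λ l → i ≤ l × l < d + i × s l ≢ s (suc l)
change s i zero    differ = ⊥-elim (differ refl)
change s i (suc d) differ with s (d + i) ≟ᵇ s (suc (d + i))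
... | no  here≢ = d + i , m≤n+m i d , ≤-refl , here≢
... | yes here≡ with change s i d (λ eq → differ (trans eq here≡))
...   | l , i≤l , l< , l≢ = l , i≤l , m≤n⇒m≤1+n l< , l≢

splitAt-injective : ∀ a {b} {u v : Fin (a + b)} → splitAt a u ≡ splitAt a v → u ≡ v
splitAt-injective a {b} {u} {v} eq =
  trans (≡-sym (join-splitAt a b u)) (trans (cong (join a b) eq) (join-splitAt a b v))

isBlock : ∀ {A B : Set} → A ⊎ B → Bool
isBlock (inj₁ _) = true
isBlock (inj₂ _) = false

-- All edges between the block and the rest get the same colour t. A rainbow cycle would use
-- at least two of them if it met both sides.
module _ {K b n t : ℕ} (b<K : b < K) (χ : Avoiding K n t) where

  open Avoiding χ

  private
    s = b C 2

  joinHue : Fin b ⊎ Fin n → Fin b ⊎ Fin n → ℕ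
  joinHue (inj₁ i) (inj₁ j) = suc t + completeHue i j
  joinHue (inj₂ i) (inj₂ j) = hue i j
  joinHue (inj₁ _) (inj₂ _) = t
  joinHue (inj₂ _) (inj₁ _) = t

  private
    hue′ : Fin (b + n) → Fin (b + n) → ℕ
    hue′ i j = joinHue (splitAt b i) (splitAt b j)

  joinHue-sym : ∀ x y → joinHue x y ≡ joinHue y x
  joinHue-sym (inj₁ i) (inj₁ j) = cong (suc t +_) (completeHue-sym i j)
  joinHue-sym (inj₂ i) (inj₂ j) = hue-sym i j
  joinHue-sym (inj₁ _) (inj₂ _) = refl
  joinHue-sym (inj₂ _) (inj₁ _) = refl

  joinHue-bound : ∀ x y → x ≢ y → joinHue x y < suc t + s
  joinHue-bound (inj₁ i) (inj₁ j) x≢y = +-monoʳ-< (suc t) (completeHue-bound (x≢y ∘ cong inj₁))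
  joinHue-bound (inj₂ i) (inj₂ j) x≢y =
    ≤-trans (bound (x≢y ∘ cong inj₂)) (≤-trans (n≤1+n t) (m≤m+n (suc t) s))
  joinHue-bound (inj₁ _) (inj₂ _) _   = m≤m+n (suc t) s
  joinHue-bound (inj₂ _) (inj₁ _) _   = m≤m+n (suc t) s

  -- The two given vertices show that both sides are nonempty, without which the joining hue `t`
  -- would not occur.
  joinHue-onto : Fin b → Fin n → ∀ {a} → a < suc t + s → ∃₂ λ x y → x ≢ y × joinHue x y ≡ a
  joinHue-onto x y {a} a< with <-cmpⁿ a t
  ... | tri< a<t _ _ with onto a<t
  ...   | i , j , i≢j , eq = inj₂ i , inj₂ j , (λ { refl → i≢j refl }) , eq
  joinHue-onto x y {a} a< | tri≈ _ refl _ = inj₁ x , inj₂ y , (λ ()) , refl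
  joinHue-onto x y {a} a< | tri> _ _ t<a with completeHue-onto b (+-cancelˡ-< (suc t) _ s
      (subst (_< suc t + s) (≡-sym (m+[n∸m]≡n t<a)) a<))
  ...   | i , j , i≢j , eq = inj₁ i , inj₁ j , (λ { refl → i≢j refl }) ,
                             trans (cong (suc t +_) eq) (m+[n∸m]≡n t<a)

  joinHue-cross : ∀ x y → isBlock x ≢ isBlock y → joinHue x y ≡ t
  joinHue-cross (inj₁ _) (inj₁ _) differ = ⊥-elim (differ refl)
  joinHue-cross (inj₂ _) (inj₂ _) differ = ⊥-elim (differ refl)
  joinHue-cross (inj₁ _) (inj₂ _) _      = refl
  joinHue-cross (inj₂ _) (inj₁ _) _      = refl

  join-acyclic : ¬ RainbowCycle K hue′
  join-acyclic (h , period , inj , rainbow) = oneSided (vertex 0) refl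
    where
    vertex : ℕ → Fin b ⊎ Fin n
    vertex i = splitAt b (h i)

    side : ℕ → Bool
    side = isBlock ∘ vertex

    -- If `h j` lay on the other side, the cycle would cross once before index `j` and once between
    -- `j` and its return to `h 0`. Both crossing edges have hue `t`, so the cycle is not rainbow.
    same-side : ∀ {i} → i < K → side 0 ≡ side i
    same-side {j} j<K with side 0 ≟ᵇ side j
    ... | yes same   = same
    ... | no  differ
      with change side 0 j (subst (λ l → side 0 ≢ side l) (≡-sym (+-identityʳ j)) differ)
         | change side j (K ∸ j) (λ eq → differ (≡-sym (trans eq
             (trans (cong side (m∸n+n≡m (<⇒≤ j<K))) (cong (isBlock ∘ splitAt b) period)))))
    ... | l , _ , l<j+0 , l≢ | l′ , j≤l′ , l′< , l′≢ = ⊥-elim (<⇒≢ (≤-trans l<j j≤l′)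
      (rainbow (≤-trans l<j (<⇒≤ j<K)) (subst (l′ <_) (m∸n+n≡m (<⇒≤ j<K)) l′<)
        (trans (joinHue-cross _ _ l≢) (≡-sym (joinHue-cross _ _ l′≢)))))
      where
      l<j : l < j
      l<j = subst (l <_) (+-identityʳ j) l<j+0

    -- A block has too few vertices for `K` distinct ones, and a cycle in the rest would be a
    -- rainbow cycle of `χ`.
    oneSided : ∀ x → vertex 0 ≡ x → ⊥
    oneSided (inj₁ x) eq = <⇒≱ b<K (injective⇒≤ {f = λ i → inBlock (toℕ i)} λ {i} {j} e →
      toℕ-injective (inj (toℕ<n i) (toℕ<n j) (splitAt-injective b (trans (inBlock-vertex (toℕ<n i))
        (trans (cong inj₁ e) (≡-sym (inBlock-vertex (toℕ<n j))))))))
      where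
      inBlock : ℕ → Fin b
      -- The default `x` is never returned at indices below `K`, where all vertices are in the
      -- block.
      inBlock i = fromInj₁ (λ _ → x) (vertex i)
      inBlock-vertex : ∀ {i} → i < K → vertex i ≡ inj₁ (inBlock i)
      inBlock-vertex {i} i<K with vertex i | same-side i<K
      ... | inj₁ _ | _ = refl
      ... | inj₂ _ | e with () ← trans (cong isBlock (≡-sym eq)) e
    oneSided (inj₂ x) eq = acyclic (h′ , h′-period ,
      (λ i<K j<K e → inj i<K j<K (splitAt-injective b
        (trans (h′-vertex (<⇒≤ i<K)) (trans (cong inj₂ e) (≡-sym (h′-vertex (<⇒≤ j<K))))))) ,
      (λ i<K j<K e → rainbow i<K j<K (trans (h′-hue i<K) (trans e (≡-sym (h′-hue j<K))))))
      where
      h′ : ℕ → Fin n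
      h′ i = fromInj₂ (λ _ → x) (vertex i)
      h′-period : h′ K ≡ h′ 0
      h′-period = cong (fromInj₂ (λ _ → x) ∘ splitAt b) period
      same-side′ : ∀ {i} → i ≤ K → side 0 ≡ side i
      same-side′ i≤K with m≤n⇒m<n∨m≡n i≤K
      ... | inj₁ i<K  = same-side i<K
      ... | inj₂ refl = cong (isBlock ∘ splitAt b) (≡-sym period)
      h′-vertex : ∀ {i} → i ≤ K → vertex i ≡ inj₂ (h′ i)
      h′-vertex {i} i≤K with vertex i | same-side′ i≤K
      ... | inj₂ _ | _ = refl
      ... | inj₁ _ | e with () ← trans (cong isBlock (≡-sym eq)) e
      h′-hue : ∀ {i} → i < K → hue′ (h i) (h (suc i)) ≡ hue (h′ i) (h′ (suc i))
      h′-hue i<K = cong₂ joinHue (h′-vertex (<⇒≤ i<K)) (h′-vertex i<K)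

  joinBlock : Fin b → Fin n → Avoiding K (b + n) (suc t + s)
  joinBlock x y = record
    { hue     = hue′
    ; hue-sym = λ i j → joinHue-sym (splitAt b i) (splitAt b j)
    ; bound   = λ i≢j → joinHue-bound _ _ (i≢j ∘ splitAt-injective b)
    ; onto    = onto′
    ; acyclic = join-acyclic
    }
    where
    onto′ : ∀ {a} → a < suc t + s → ∃₂ λ i j → i ≢ j × hue′ i j ≡ a
    onto′ a< with joinHue-onto x y a<
    ... | u , v , u≢v , eq = join b n u , join b n v ,
      (λ e → u≢v (trans (≡-sym (splitAt-join b n u)) (trans (cong (splitAt b) e) (splitAt-join b n v)))) ,
      trans (cong₂ joinHue (splitAt-join b n u) (splitAt-join b n v)) eq

-- Each block contributes the colours of its own edges and one joining colour. Size `suc b` and the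
-- vertex of `Fin n` keep both sides of every join nonempty.
joinBlocks : ∀ {K b n t} → suc b < K → Fin n → Avoiding K n t → ∀ q →
             Avoiding K (q * suc b + n) (q * suc (suc b C 2) + t)
joinBlocks _ _ χ zero = χ
joinBlocks {K} {b} {n} {t} b<K x χ (suc q) =
  subst₂ (Avoiding K) (≡-sym (+-assoc (suc b) (q * suc b) n)) (regroup (suc b C 2) (q * suc (suc b C 2)) t)
    (joinBlock b<K (joinBlocks b<K x χ q) Fin.zero ((q * suc b) ↑ʳ x))
  where
  regroup : ∀ s u t → suc (u + t) + s ≡ suc s + u + t
  regroup = solve-∀

-- From hues to colourings without a rainbow copy

-- Hues of edges are already below `suc t`; the reduction only serves to bring the diagonal values
-- into range.
toColouring : ∀ {K n t} → Avoiding K n (suc t) → Colouring n (suc t)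
toColouring {t = t} χ = record
  { col  = λ i j → hue i j mod suc t
  ; csym = λ i j → cong (_mod suc t) (hue-sym i j)
  ; surj = λ a → attained a
  }
  where
  open Avoiding χ
  attained : ∀ a → ∃ λ i → ∃ λ j → i ≢ j × hue i j mod suc t ≡ a
  attained a with onto (toℕ<n a)
  ... | i , j , i≢j , eq = i , j , i≢j , toℕ-injective
    (trans (toℕ-fromℕ< _) (trans (cong (_% suc t) eq) (m<n⇒m%n≡m (toℕ<n a))))

-- The equations give `i = j + 1` and `j = i + 1` modulo the length `k + 2`, hence 2 = 0 modulo a
-- number that is at least 3.
cycle-no-reversal : ∀ {A : Set} {k} (h : ℕ → A) → 1 ≤ k → h (suc (suc k)) ≡ h 0 →
  (∀ {i j} → i ≤ suc k → j ≤ suc k → h i ≡ h j → i ≡ j) →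
  ∀ {i j} → i ≤ suc k → j ≤ suc k → h i ≡ h (suc j) → h (suc i) ≡ h j → ⊥
cycle-no-reversal {k = k} h 1≤k period inj i≤ j≤ e e′ with at i≤ j≤ e | at j≤ i≤ (≡-sym e′)
  where
  at : ∀ {i j} → i ≤ suc k → j ≤ suc k → h i ≡ h (suc j) → i ≡ suc j ⊎ (i ≡ 0 × j ≡ suc k)
  at {i} {j} i≤ j≤ e with m≤n⇒m<n∨m≡n j≤
  ... | inj₁ j<   = inj₁ (inj i≤ j< e)
  ... | inj₂ refl = inj₂ (inj i≤ z≤n (trans e period) , refl)
... | inj₁ refl          | inj₁ ()
... | inj₁ refl          | inj₂ (refl , refl) with () ← 1≤k
cycle-no-reversal _ 1≤k _ _ _ _ _ _ | inj₂ (refl , refl) | inj₁ refl with () ← 1≤k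
cycle-no-reversal _ _ _ _ _ _ _ _ | inj₂ (refl , refl) | inj₂ (() , _)

-- The image of the cycle under the copy would be a rainbow cycle. A copy distinguishes edges only
-- up to orientation, so the reversed case has to be excluded.
avoiding⇒¬rainbowCopy : ∀ {p k n t} (H : Graph p) (h : ℕ → Fin p) → 1 ≤ k →
  (∀ {i j} → i ≤ suc k → j ≤ suc k → h i ≡ h j → i ≡ j) →
  (∀ i → Adj H (h i) (h (suc i))) → h (suc (suc k)) ≡ h 0 →
  (χ : Avoiding (suc (suc k)) n (suc t)) → ¬ RainbowCopy (toColouring χ) H
avoiding⇒¬rainbowCopy {t = t} H h 1≤k h-inj h-adj period χ (f , f-inj , rainbow) =
  acyclic (f ∘ h , cong f period , (λ i< j< e → h-inj (≤-pred i<) (≤-pred j<) (f-inj e)) , distinct)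
  where
  open Avoiding χ
  distinct : ∀ {i j} → i < _ → j < _ →
             hue (f (h i)) (f (h (suc i))) ≡ hue (f (h j)) (f (h (suc j))) → i ≡ j
  distinct {i} {j} i< j< e with rainbow _ _ _ _ (h-adj i) (h-adj j) (cong (_mod suc t) e)
  ... | inj₁ (eq , _)   = h-inj (≤-pred i<) (≤-pred j<) eq
  ... | inj₂ (eq , eq′) =
    ⊥-elim (cycle-no-reversal h 1≤k period h-inj (≤-pred i<) (≤-pred j<) eq eq′)

-- If `m ≤ t`, the property of `m` would force a rainbow copy in the derived colouring. The case
-- `t = 0` cannot occur: `2 ≤ n` provides an edge, and its hue is below `t`.
avoiding⇒<rainbowNumber : ∀ {p k n t m} (H : Graph p) → ContainsCycle H (suc (suc k)) → 2 ≤ n →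
  Avoiding (suc (suc k)) n t → IsRainbowNumber n H m → t < m
avoiding⇒<rainbowNumber {t = zero} _ _ (s≤s (s≤s _)) χ _
  with () ← Avoiding.bound χ {Fin.zero} {Fin.suc Fin.zero} (λ ())
avoiding⇒<rainbowNumber {k = k} {t = suc t} H (s≤s (s≤s 1≤k) , c , c-inj , c-adj) _ χ (copy , _) =
  ≰⇒> λ m≤t → avoiding⇒¬rainbowCopy H (c ∘ around) 1≤k
    (λ i≤ j≤ eq → around-injective i≤ j≤ (c-inj eq))
    (λ i → c-adj (around i)) (cong c (around-period (suc k))) χ
    (copy (suc t) m≤t (toColouring χ))

-- The lower bound

lowerBound : ∀ {p k n m} (H : Graph p) → ContainsCycle H (suc (suc k)) → 2 ≤ n →
  IsRainbowNumber n H m →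
  (n / suc k) * (suc k C 2) + ((n % suc k) C 2) + ⌈ n / suc k ⌉ ≤ m
lowerBound {k = k} {n} {m} H cyc 2≤n rb =
  blocks (n / suc k) (n % suc k) (m%n<n n (suc k)) (m≡m%n+[m/n]*n n (suc k))
  where
  d = suc k
  ceil≤ : ∀ q → n ≤ q * d → ⌈ n / d ⌉ ≤ q
  ceil≤ q n≤ = ≤-pred (m<n*o⇒m/o<n (begin-strict
    n + k      ≤⟨ +-monoˡ-≤ k n≤ ⟩
    q * d + k  <⟨ +-monoʳ-< (q * d) ≤-refl ⟩
    q * d + d  ≡⟨ +-comm (q * d) d ⟩
    suc q * d  ∎))
    where open ≤-Reasoning

  -- For remainder zero one of the full blocks is the base, otherwise the base has `r` vertices.
  -- Either way there is one joining colour fewer than there are blocks; the strict inequality below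
  -- `m` makes up for it, and the number of blocks bounds the ceiling.
  blocks : ∀ q r → r < d → n ≡ r + q * d → q * (d C 2) + r C 2 + ⌈ n / d ⌉ ≤ m
  blocks zero zero _ n≡0 with () ← subst (2 ≤_) n≡0 2≤n
  blocks (suc q) zero _ n≡ = begin
    suc q * (d C 2) + 0 + ⌈ n / d ⌉  ≤⟨ +-monoʳ-≤ (suc q * (d C 2) + 0) (ceil≤ (suc q) (≤-reflexive n≡)) ⟩
    suc q * (d C 2) + 0 + suc q      ≡⟨ regroup q (d C 2) ⟩
    suc (q * suc (d C 2) + d C 2)    ≤⟨ avoiding⇒<rainbowNumber H cyc 2≤n χ rb ⟩
    m                                ∎
    where
    open ≤-Reasoning
    regroup : ∀ q s → suc q * s + 0 + suc q ≡ suc (q * suc s + s)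
    regroup = solve-∀
    χ : Avoiding (suc d) n (q * suc (d C 2) + d C 2)
    χ = subst (λ n → Avoiding (suc d) n (q * suc (d C 2) + d C 2)) (≡-sym (trans n≡ (+-comm d (q * d))))
          (joinBlocks ≤-refl Fin.zero (complete ≤-refl) q)
  blocks q (suc r) r<d n≡ = begin
    q * (d C 2) + suc r C 2 + ⌈ n / d ⌉   ≤⟨ +-monoʳ-≤ (q * (d C 2) + suc r C 2) (ceil≤ (suc q) n≤) ⟩
    q * (d C 2) + suc r C 2 + suc q       ≡⟨ regroup q (d C 2) (suc r C 2) ⟩
    suc (q * suc (d C 2) + suc r C 2)     ≤⟨ avoiding⇒<rainbowNumber H cyc 2≤n χ rb ⟩
    m                                     ∎
    where
    open ≤-Reasoning
    regroup : ∀ q s u → q * s + u + suc q ≡ suc (q * suc s + u)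
    regroup = solve-∀
    n≤ : n ≤ suc q * d
    n≤ = ≤-trans (≤-reflexive n≡) (+-monoˡ-≤ (q * d) (<⇒≤ r<d))
    χ : Avoiding (suc d) n (q * suc (d C 2) + suc r C 2)
    χ = subst (λ n → Avoiding (suc d) n (q * suc (d C 2) + suc r C 2))
          (≡-sym (trans n≡ (+-comm (suc r) (q * d))))
          (joinBlocks ≤-refl Fin.zero (complete (m≤n⇒m≤1+n r<d)) q)

-- The upper bound

-- With `p = 3 + q` this makes `p (p - 3) / 2` available as a natural number; from `q` to `q + 1` it
-- grows by `2 + q`.
half[3+q]*q : ∀ q → ∃ λ w → 2 * w ≡ (3 + q) * q
half[3+q]*q zero    = 0 , refl
half[3+q]*q (suc q) with half[3+q]*q q
... | w , eq = w + (2 + q) , trans (*-distribˡ-+ 2 w (2 + q)) (trans (cong (_+ 2 * (2 + q)) eq) (expand q))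
  where
  expand : ∀ q → (3 + q) * q + 2 * (2 + q) ≡ (4 + q) * suc q
  expand = solve-∀

upperBound : ∀ {q k n m} (H : Graph (3 + q)) → Connected H → HasCyclomaticNumber H 1 →
  ContainsCycle H (suc (suc k)) → 3 + q ≤ n → IsRainbowNumber n H m →
  2 * m + (3 + q) * q ≤ 2 * ((1 + q) * n)
upperBound {q} {k} {n} {m} H conn cyc (s≤s (s≤s 1≤k) , c , c-inj , c-adj) p≤n (_ , least)
  with half[3+q]*q q
... | w , 2w = begin
  2 * m + (3 + q) * q  ≤⟨ +-monoˡ-≤ ((3 + q) * q) (*-monoʳ-≤ 2 (least M copy)) ⟩
  2 * M + (3 + q) * q  ≡⟨ 2M ⟩
  2 * ((1 + q) * n)    ∎
  where
  open ≤-Reasoning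
  -- The claimed bound itself; `w≤` shows that the subtraction is not truncated. By minimality of
  -- `m` it suffices that `M` has the rainbow property.
  M : ℕ
  M = (1 + q) * n ∸ w

  w≤ : w ≤ (1 + q) * n
  w≤ = *-cancelˡ-≤ 2 (begin
    2 * w              ≡⟨ 2w ⟩
    (3 + q) * q        ≤⟨ *-mono-≤ p≤n (n≤1+n q) ⟩
    n * (1 + q)        ≡⟨ *-comm n (1 + q) ⟩
    (1 + q) * n        ≤⟨ m≤m+n _ _ ⟩
    2 * ((1 + q) * n)  ∎)

  2M : 2 * M + (3 + q) * q ≡ 2 * ((1 + q) * n)
  2M = trans (cong (2 * M +_) (≡-sym 2w)) (trans (≡-sym (*-distribˡ-+ 2 M w)) (cong (2 *_) (m∸n+n≡m w≤)))

  copy : RbProperty n H M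
  copy t M≤t χ with cycle-growth H (c ∘ around) 1≤k
                      (λ i≤ j≤ eq → around-injective i≤ j≤ (c-inj eq))
                      (λ i → c-adj (around i)) (cong c (around-period (suc k)))
  ... | _ , _ , G with growth-complete H conn G
  -- `n ∸ (2 + q)` is the number of vertices beyond `p - 1`, the most that can be deleted.
  ... | _ , _ , G′ , full = many-colours⇒rainbowCopy χ H G′ full cyc (n ∸ (2 + q)) (allFin n)
    (trans (length-allFin n) (≡-sym (m∸n+n≡m (≤-trans (n≤1+n (2 + q)) p≤n))))
    (begin
      2 * ((1 + q) * length (allFin n))                    ≡⟨ cong (λ l → 2 * ((1 + q) * l)) (length-allFin n) ⟩
      2 * ((1 + q) * n)                                    ≡⟨ 2M ⟨
      2 * M + (3 + q) * q                                  ≤⟨ +-monoˡ-≤ ((3 + q) * q) (*-monoʳ-≤ 2 M≤t) ⟩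
      2 * t + (3 + q) * q                                  ≡⟨ cong (λ l → 2 * l + (3 + q) * q) (colours-allFin χ) ⟨
      2 * length (colours χ (allFin n)) + (3 + q) * q      ∎)

theorem5 : ∀ (p : ℕ) (H : Graph p) (k : ℕ) →
    5 ≤ p → Connected H → HasCyclomaticNumber H 1 →
    ContainsCycle H (suc (suc k)) → suc (suc k) ≤ p ∸ 2 →
    ∀ (n : ℕ) → p ≤ n → ∀ (m : ℕ) → IsRainbowNumber n H m →
    ((n / suc k) * (suc k C 2) + ((n % suc k) C 2) + ⌈ n / suc k ⌉ ≤ m)
    × (2 * m + p * (p ∸ 3) ≤ 2 * ((p ∸ 2) * n))
theorem5 (suc (suc (suc q))) H k 5≤p conn unicyclic cyc _ n p≤n m rb =
  lowerBound H cyc (≤-trans (s≤s (s≤s z≤n)) p≤n) rb , upperBound H conn unicyclic cyc p≤n rb
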